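{- The generating function for the number of restricted growth sequences of length $n$ ($n\ge 0$) that avoid $\{12313,12323,12333\}$ is $$\sum_{n\ge0}|\mathcal P_n(\{12313,12323,12333\})|\,x^n=1+\frac{x\left(3-9x+\sqrt{1-2x-3x^2}\right)}{2(2-7x)(1-x)}.$$
   Context: A restricted growth sequence of length $n$ is a sequence of positive integers $\pi=\pi_1\cdots\pi_n$ with $\pi_1=1$ and $\pi_{j+1}\le 1+\max\{\pi_1,\dots,\pi_j\}$ for all $1\le j<n$ (the empty sequence is the only one of length $0$). Such a sequence contains a pattern $\tau$ if it has a (not necessarily consecutive) subsequence order isomorphic to $\tau$ (same relative order, including equalities); otherwise it avoids $\tau$. $\mathcal P_n(B)$ is the set of restricted growth sequences of length $n$ that avoid all patterns in $B$. -}

module Defs where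

open import Data.Bool using (true; false; if_then_else_; T)
open import Data.Empty using (⊥-elim)
open import Data.Fin as Fin using (Fin; zero; suc; toℕ)
import Data.Fin.Properties as Fin
open import Data.Integer using (+_)
open import Data.List using (List; []; _∷_; length; lookup; take; filter; applyUpTo; cartesianProductWith)
open import Data.List.Extrema.Nat using (max; max≤v⁺)
open import Data.List.Membership.Propositional using (_∈_)
open import Data.List.Membership.Propositional.Properties
  using (∈-cartesianProductWith⁺; ∈-cartesianProductWith⁻; ∈-applyUpTo⁺; ∈-applyUpTo⁻; ∈-filter⁺; ∈-filter⁻)
open import Data.List.Properties using (∷-injective)
open import Data.List.Relation.Binary.Sublist.Propositional using (_⊆_; []; _∷_; _∷ʳ_)
open import Data.List.Relation.Unary.All as All using (All; []; _∷_)
open import Data.List.Relation.Unary.AllPairs using ([]; _∷_)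
open import Data.List.Relation.Unary.Any using (here; there)
open import Data.List.Relation.Unary.Unique.Propositional using (Unique)
import Data.List.Relation.Unary.Unique.Propositional.Properties as Unique
open import Data.Nat as ℕ using (ℕ; zero; suc; _≤_; _<_; _∸_; z≤n; s≤s)
import Data.Nat.Properties as ℕ
open import Data.Product using (∃-syntax; Σ-syntax; _×_; _,_; proj₁; proj₂)
open import Data.Rational as ℚ using (ℚ; 0ℚ; 1ℚ; ½)
import Data.Rational.Properties as ℚ
open import Function using (_∘_; _⇔_; mk⇔; Equivalence)
open import Relation.Binary.PropositionalEquality
open import Relation.Nullary using (Dec; yes; no; ¬_; ¬?; _×-dec_; _→-dec_)
open import Relation.Nullary.Decidable using (map′)
open import Relation.Unary using (Decidable)
open import Algebra.Properties.Monoid.Sum ℚ.+-0-monoid using (sum; sum-cong-≗; sum-init-last)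

------------------------------------------------------------------------
-- Restricted growth sequences

-- `toℕ i` is the 0-based position, so the entries strictly before
-- position i are `take (toℕ i) π`.
record IsRGS (π : List ℕ) : Set where
  field
    positive : ∀ i → 1 ≤ lookup π i
    first    : ∀ i → toℕ i ≡ 0 → lookup π i ≡ 1
    growth   : ∀ i → 1 ≤ toℕ i → lookup π i ≤ 1 ℕ.+ max 0 (take (toℕ i) π)

OrderIsomorphic : List ℕ → List ℕ → Set
OrderIsomorphic σ τ =
  Σ[ eq ∈ length σ ≡ length τ ] ∀ i j →
    let i′ = Fin.cast eq i ; j′ = Fin.cast eq j in
    (lookup σ i < lookup σ j ⇔ lookup τ i′ < lookup τ j′) ×
    (lookup σ i ≡ lookup σ j ⇔ lookup τ i′ ≡ lookup τ j′)

Contains : List ℕ → List ℕ → Set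
Contains π τ = ∃[ σ ] σ ⊆ π × OrderIsomorphic σ τ

Avoids : List ℕ → List ℕ → Set
Avoids π τ = ¬ Contains π τ

𝒫 : ℕ → List (List ℕ) → List ℕ → Set
𝒫 n B π = length π ≡ n × IsRGS π × All (Avoids π) B

------------------------------------------------------------------------
-- Decidability

private
  infix 3 _⇔-dec_
  _⇔-dec_ : {A B : Set} → Dec A → Dec B → Dec (A ⇔ B)
  a? ⇔-dec b? =
    map′ (λ (f , g) → mk⇔ f g) (λ e → Equivalence.to e , Equivalence.from e)
         ((a? →-dec b?) ×-dec (b? →-dec a?))

  anySublist? : {P : List ℕ → Set} → Decidable P → ∀ π → Dec (∃[ σ ] σ ⊆ π × P σ)
  anySublist? P? [] with P? []
  ... | yes p = yes ([] , [] , p)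
  ... | no ¬p = no λ { ([] , [] , p) → ¬p p }
  anySublist? P? (x ∷ π) with anySublist? P? π
  ... | yes (σ , s , p) = yes (σ , x ∷ʳ s , p)
  ... | no ¬a with anySublist? (P? ∘ (x ∷_)) π
  ...   | yes (σ , s , p) = yes (x ∷ σ , refl ∷ s , p)
  ...   | no ¬b = no λ { (σ , _ ∷ʳ s , p) → ¬a (σ , s , p)
                       ; (_ ∷ σ , refl ∷ s , p) → ¬b (σ , s , p) }

isRGS? : Decidable IsRGS
isRGS? π = map′
  (λ (p , f , g) → record { positive = p ; first = f ; growth = g })
  (λ r → IsRGS.positive r , IsRGS.first r , IsRGS.growth r)
  (Fin.all? (λ i → 1 ℕ.≤? lookup π i)
   ×-dec Fin.all? (λ i → (toℕ i ℕ.≟ 0) →-dec (lookup π i ℕ.≟ 1))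
   ×-dec Fin.all? (λ i → (1 ℕ.≤? toℕ i) →-dec
                         (lookup π i ℕ.≤? 1 ℕ.+ max 0 (take (toℕ i) π))))

orderIsomorphic? : ∀ σ τ → Dec (OrderIsomorphic σ τ)
orderIsomorphic? σ τ with length σ ℕ.≟ length τ
... | no ¬eq = no (¬eq ∘ proj₁)
... | yes eq = map′ (eq ,_) proj₂
  (Fin.all? λ i → Fin.all? λ j →
    ((_ ℕ.<? _) ⇔-dec (_ ℕ.<? _)) ×-dec ((_ ℕ.≟ _) ⇔-dec (_ ℕ.≟ _)))

contains? : ∀ π τ → Dec (Contains π τ)
contains? π τ = anySublist? (λ σ → orderIsomorphic? σ τ) π

𝒫? : ∀ n B → Decidable (𝒫 n B)
𝒫? n B π =
  (length π ℕ.≟ n) ×-dec isRGS? π ×-dec All.all? (λ τ → ¬? (contains? π τ)) B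

------------------------------------------------------------------------
-- Cardinality of 𝒫 n B

words : ℕ → ℕ → List (List ℕ)
words m zero    = [] ∷ []
words m (suc n) = cartesianProductWith _∷_ (applyUpTo suc m) (words m n)

-- Entries of a restricted growth sequence of length n lie in {1,…,n};
-- ∈-list𝒫 and list𝒫-unique show that nothing is missed or repeated.
list𝒫 : ℕ → List (List ℕ) → List (List ℕ)
list𝒫 n B = filter (𝒫? n B) (words n n)

∣𝒫∣ : ℕ → List (List ℕ) → ℕ
∣𝒫∣ n B = length (list𝒫 n B)

private
  All-lookup : {P : ℕ → Set} (π : List ℕ) → (∀ i → P (lookup π i)) → All P π
  All-lookup []      h = []
  All-lookup (x ∷ π) h = h zero ∷ All-lookup π (h ∘ suc)

  take-lookup : {P : ℕ → Set} (π : List ℕ) (m : ℕ) →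
    (∀ i → toℕ i < m → P (lookup π i)) → All P (take m π)
  take-lookup π       zero    h = []
  take-lookup []      (suc m) h = []
  take-lookup (x ∷ π) (suc m) h =
    h zero (s≤s z≤n) ∷ take-lookup π m (λ i i<m → h (suc i) (s≤s i<m))

  bound : ∀ {π} → IsRGS π → ∀ m i → toℕ i < m → lookup π i ≤ m
  bound {π} r (suc m) i (s≤s i≤m) with toℕ i in eq
  ... | zero  = subst (_≤ suc m) (sym (IsRGS.first r i eq)) (s≤s z≤n)
  ... | suc k = ℕ.≤-trans (IsRGS.growth r i (subst (1 ≤_) (sym eq) (s≤s z≤n)))
    (s≤s (max≤v⁺ z≤n (take-lookup π (toℕ i)
      (λ j j<i → bound r m j (ℕ.≤-trans j<i (subst (_≤ m) (sym eq) i≤m))))))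

  ∈-words : ∀ {m} π → All (λ x → 1 ≤ x × x ≤ m) π → π ∈ words m (length π)
  ∈-words []          []                = here refl
  ∈-words (suc x ∷ π) ((_ , x<m) ∷ ps) =
    ∈-cartesianProductWith⁺ _∷_ (∈-applyUpTo⁺ suc x<m) (∈-words π ps)

  words-unique : ∀ m n → Unique (words m n)
  words-unique m zero    = [] ∷ []
  words-unique m (suc n) = Unique.cartesianProductWith⁺ _∷_ ∷-injective
    (Unique.applyUpTo⁺₁ suc m (λ i<j _ eq → ℕ.<⇒≢ i<j (ℕ.suc-injective eq)))
    (words-unique m n)

∈-list𝒫 : ∀ n B π → π ∈ list𝒫 n B ⇔ 𝒫 n B π
∈-list𝒫 n B π = mk⇔
  (λ π∈ → proj₂ (∈-filter⁻ (𝒫? n B) {xs = words n n} π∈))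
  λ { p@(refl , r , _) → ∈-filter⁺ (𝒫? n B)
        (∈-words π (All-lookup π (λ i →
          IsRGS.positive r i , bound r (length π) i (Fin.toℕ<n i)))) p }

list𝒫-unique : ∀ n B → Unique (list𝒫 n B)
list𝒫-unique n B = Unique.filter⁺ (𝒫? n B) (words-unique n n)

------------------------------------------------------------------------
-- Formal power series over ℚ

PowerSeries : Set
PowerSeries = ℕ → ℚ

infix  4 _≈_
infixl 6 _+_ _-_
infixl 7 _*_ _/_
infix  9 √_

_≈_ : PowerSeries → PowerSeries → Set
f ≈ g = ∀ n → f n ≡ g n

fromℕ : ℕ → ℚ
fromℕ n = + n ℚ./ 1

monomial : ℕ → ℚ → PowerSeries
monomial m c n = if n ℕ.≡ᵇ m then c else 0ℚ

C : ℕ → PowerSeries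
C k = monomial 0 (fromℕ k)

X : PowerSeries
X = monomial 1 1ℚ

_+_ _-_ _*_ : PowerSeries → PowerSeries → PowerSeries
(f + g) n = f n ℚ.+ g n
(f - g) n = f n ℚ.- g n
(f * g) n = sum {suc n} λ k → f (toℕ k) ℚ.* g (n ∸ toℕ k)

-- Long division: after the leading coefficient q₀ = f₀ / g₀, continue with
-- (f - q₀ g) / x.
_/_ : (f g : PowerSeries) → .{{ℚ.NonZero (g 0)}} → PowerSeries
(f / g) zero    = f 0 ℚ.÷ g 0
(f / g) (suc n) = ((λ k → f (suc k) ℚ.- (f 0 ℚ.÷ g 0) ℚ.* g (suc k)) / g) n

-- √ f is the square root of f with constant coefficient 1; it is meaningful
-- only when f has constant coefficient 1.  √-approx f n is its truncation to
-- degree ≤ n, whose next coefficient c is determined by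
-- f (n + 1) = (√-approx f n * √-approx f n) (n + 1) + 2 c.
√-approx : PowerSeries → ℕ → PowerSeries
√-approx f zero    = C 1
√-approx f (suc n) =
  S + monomial (suc n) (½ ℚ.* (f (suc n) ℚ.- (S * S) (suc n)))
  where S = √-approx f n

√_ : PowerSeries → PowerSeries
(√ f) n = √-approx f n n

/-spec : ∀ f g .{{_ : ℚ.NonZero (g 0)}} → (f / g) * g ≈ f
/-spec f g zero = begin
  (f 0 ℚ.* (ℚ.1/ g 0)) ℚ.* g 0 ℚ.+ 0ℚ ≡⟨ ℚ.+-identityʳ _ ⟩
  (f 0 ℚ.* (ℚ.1/ g 0)) ℚ.* g 0        ≡⟨ ℚ.*-assoc (f 0) _ _ ⟩
  f 0 ℚ.* ((ℚ.1/ g 0) ℚ.* g 0)        ≡⟨ cong (f 0 ℚ.*_) (ℚ.*-inverseˡ (g 0)) ⟩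
  f 0 ℚ.* 1ℚ                          ≡⟨ ℚ.*-identityʳ _ ⟩
  f 0                                 ∎
  where open ≡-Reasoning
/-spec f g (suc n) = begin
  q ℚ.+ ((f′ / g) * g) n           ≡⟨ cong (q ℚ.+_) (/-spec f′ g n) ⟩
  q ℚ.+ (f (suc n) ℚ.- q)          ≡⟨ cong (q ℚ.+_) (ℚ.+-comm (f (suc n)) _) ⟩
  q ℚ.+ (ℚ.- q ℚ.+ f (suc n))      ≡⟨ ℚ.+-assoc q _ _ ⟨
  (q ℚ.+ ℚ.- q) ℚ.+ f (suc n)      ≡⟨ cong (ℚ._+ f (suc n)) (ℚ.+-inverseʳ q) ⟩
  0ℚ ℚ.+ f (suc n)                 ≡⟨ ℚ.+-identityˡ _ ⟩
  f (suc n)                        ∎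
  where
  open ≡-Reasoning
  q = (f 0 ℚ.÷ g 0) ℚ.* g (suc n)
  f′ : PowerSeries
  f′ k = f (suc k) ℚ.- (f 0 ℚ.÷ g 0) ℚ.* g (suc k)

private
  monomial-≡ : ∀ m c → monomial m c m ≡ c
  monomial-≡ m c with m ℕ.≡ᵇ m in eq
  ... | true  = refl
  ... | false = ⊥-elim (subst T eq (ℕ.≡⇒≡ᵇ m m refl))

  monomial-≢ : ∀ m c n → n ≢ m → monomial m c n ≡ 0ℚ
  monomial-≢ m c n n≢m with n ℕ.≡ᵇ m in eq
  ... | false = refl
  ... | true  = ⊥-elim (n≢m (ℕ.≡ᵇ⇒≡ n m (subst T (sym eq) _)))

  approx-high : ∀ f n k → n < k → √-approx f n k ≡ 0ℚ
  approx-high f zero    k n<k = monomial-≢ 0 1ℚ k (ℕ.<⇒≢ n<k ∘ sym)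
  approx-high f (suc n) k n<k = cong₂ ℚ._+_
    (approx-high f n k (ℕ.<-trans (ℕ.n<1+n n) n<k))
    (monomial-≢ (suc n) _ k (ℕ.<⇒≢ n<k ∘ sym))

  approx-low : ∀ f n k → k ≤ n → √-approx f n k ≡ (√ f) k
  approx-low f zero    zero z≤n = refl
  approx-low f (suc n) k    k≤n with k ℕ.≟ suc n
  ... | yes refl = refl
  ... | no k≢    = trans
    (cong₂ ℚ._+_ (approx-low f n k (ℕ.s≤s⁻¹ (ℕ.≤∧≢⇒< k≤n k≢)))
                 (monomial-≢ (suc n) _ k k≢))
    (ℚ.+-identityʳ _)

  middle : PowerSeries → ℕ → ℚ
  middle s n = sum {n} λ k → s (suc (toℕ k)) ℚ.* s (n ∸ toℕ k)

  square-suc : ∀ s n →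
    (s * s) (suc n) ≡ s 0 ℚ.* s (suc n) ℚ.+ (middle s n ℚ.+ s (suc n) ℚ.* s 0)
  square-suc s n = cong (s 0 ℚ.* s (suc n) ℚ.+_)
    (trans (sum-init-last {n} t) (cong₂ ℚ._+_
      (sum-cong-≗ {n} (λ k → cong (λ m → s (suc m) ℚ.* s (n ∸ m)) (Fin.toℕ-inject₁ k)))
      (trans (cong (λ m → s (suc m) ℚ.* s (n ∸ m)) (Fin.toℕ-fromℕ n))
             (cong (λ m → s (suc n) ℚ.* s m) (ℕ.n∸n≡0 n)))))
    where
    t : Fin (suc n) → ℚ
    t k = s (suc (toℕ k)) ℚ.* s (n ∸ toℕ k)

√-constant : ∀ f → (√ f) 0 ≡ 1ℚ
√-constant f = refl

√-spec : ∀ f → f 0 ≡ 1ℚ → √ f * √ f ≈ f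
√-spec f f0 zero    = sym f0
√-spec f f0 (suc n) = begin
  (S * S) (suc n)
    ≡⟨ square-suc S n ⟩
  1ℚ ℚ.* S (suc n) ℚ.+ (middle S n ℚ.+ S (suc n) ℚ.* 1ℚ)
    ≡⟨ cong₂ ℚ._+_ (ℚ.*-identityˡ (S (suc n)))
                  (cong₂ ℚ._+_ (sym middle≡) (ℚ.*-identityʳ (S (suc n)))) ⟩
  S (suc n) ℚ.+ (M ℚ.+ S (suc n))
    ≡⟨ cong (λ s → s ℚ.+ (M ℚ.+ s)) S-suc ⟩
  c ℚ.+ (M ℚ.+ c)
    ≡⟨ cong (c ℚ.+_) (ℚ.+-comm M c) ⟩
  c ℚ.+ (c ℚ.+ M)
    ≡⟨ ℚ.+-assoc c c M ⟨
  (c ℚ.+ c) ℚ.+ M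
    ≡⟨ cong (ℚ._+ M) (ℚ.*-distribʳ-+ d ½ ½) ⟨
  1ℚ ℚ.* d ℚ.+ M
    ≡⟨ cong (ℚ._+ M) (ℚ.*-identityˡ d) ⟩
  (f (suc n) ℚ.- (A * A) (suc n)) ℚ.+ M
    ≡⟨ cong (λ m → (f (suc n) ℚ.- m) ℚ.+ M) A² ⟩
  (f (suc n) ℚ.- M) ℚ.+ M
    ≡⟨ ℚ.+-assoc (f (suc n)) _ M ⟩
  f (suc n) ℚ.+ (ℚ.- M ℚ.+ M)
    ≡⟨ cong (f (suc n) ℚ.+_) (ℚ.+-inverseˡ M) ⟩
  f (suc n) ℚ.+ 0ℚ
    ≡⟨ ℚ.+-identityʳ _ ⟩
  f (suc n) ∎
  where
  open ≡-Reasoning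
  S A : PowerSeries
  S = √ f
  A = √-approx f n
  M d c : ℚ
  M = middle A n
  d = f (suc n) ℚ.- (A * A) (suc n)
  c = ½ ℚ.* d
  top : A (suc n) ≡ 0ℚ
  top = approx-high f n (suc n) (ℕ.n<1+n n)
  S-suc : S (suc n) ≡ c
  S-suc = trans (cong₂ ℚ._+_ top (monomial-≡ (suc n) c)) (ℚ.+-identityˡ c)
  middle≡ : M ≡ middle S n
  middle≡ = sum-cong-≗ {n} λ k → cong₂ ℚ._*_
    (approx-low f n (suc (toℕ k)) (Fin.toℕ<n k))
    (approx-low f n (n ∸ toℕ k) (ℕ.m∸n≤m n (toℕ k)))
  A² : (A * A) (suc n) ≡ M
  A² = begin
    (A * A) (suc n)
      ≡⟨ square-suc A n ⟩
    A 0 ℚ.* A (suc n) ℚ.+ (M ℚ.+ A (suc n) ℚ.* A 0)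
      ≡⟨ cong (λ a → A 0 ℚ.* a ℚ.+ (M ℚ.+ a ℚ.* A 0)) top ⟩
    A 0 ℚ.* 0ℚ ℚ.+ (M ℚ.+ 0ℚ ℚ.* A 0)
      ≡⟨ cong₂ ℚ._+_ (ℚ.*-zeroʳ (A 0)) (cong (M ℚ.+_) (ℚ.*-zeroˡ (A 0))) ⟩
    0ℚ ℚ.+ (M ℚ.+ 0ℚ)
      ≡⟨ trans (ℚ.+-identityˡ _) (ℚ.+-identityʳ M) ⟩
    M ∎

generatingFunction : (ℕ → ℕ) → PowerSeries
generatingFunction a n = fromℕ (a n)

patterns : List (List ℕ)
patterns = (1 ∷ 2 ∷ 3 ∷ 1 ∷ 3 ∷ []) ∷ (1 ∷ 2 ∷ 3 ∷ 2 ∷ 3 ∷ []) ∷ (1 ∷ 2 ∷ 3 ∷ 3 ∷ 3 ∷ []) ∷ []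

module Submission where

-- In a restricted growth sequence the letters 1, ..., c - 1 occur in this
-- order before the first c.  Hence a sequence avoids the three patterns iff for
-- every letter c at least 3 all entries strictly between two occurrences of c are
-- greater than c (avoids⇔separated).  In particular such a c occurs at most
-- twice.
--
-- Such sequences are read from left to right, remembering the maximum m so far
-- and the stack of those letters at least 3 that may occur once more.  Once 1 and 2
-- have occurred, the next letter is m + 1, which is pushed; or 1 or 2, which clear
-- the stack; or a letter z of the stack, which removes z and all the larger
-- letters.  The number of completions depends only on the length n of the
-- completion and the height h of the stack, and
--
--   N(n+1,h) = N(n,h+1) + 2 N(n,0) + N(n,0) + ... + N(n,h-1).
--
-- Let M = 1 + x M + x^2 M^2 be the series of the Motzkin numbers and let Y be
-- M / (1 - 2 x M).  The series (1 + x M)^h Y satisfy this recurrence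
-- (W-recurrence), which determines its solution, so the completions of height h
-- have the generating function (1 + x M)^h Y.  A nonempty sequence is a block of
-- ones, possibly followed by a 2 and a completion of height 0, so its length has
-- the generating function x (1 + x Y) / (1 - x).  Since
-- M = (1 - x - S) / (2 x^2), where S is the square root of 1 - 2x - 3x^2, this is
-- the stated series (Y-closed, total-series).

open import Defs
open import Data.Nat using (nonZero)

open import Algebra.Bundles using (CommutativeRing)
open import Algebra.Consequences.Setoid using (comm∧idˡ⇒id; comm∧distrʳ⇒distr)
import Algebra.Solver.Ring as RingSolver
open import Algebra.Solver.Ring.AlmostCommutativeRing
  using (fromCommutativeRing; _-Raw-AlmostCommutative⟶_)
open import Data.Empty using (⊥-elim)
open import Data.Fin as Fin using (zero; suc; toℕ)
open import Data.Fin.Patterns using (0F; 1F; 2F; 3F; 4F)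
import Data.Integer as ℤ
import Data.Integer.Solver as ℤ-Solver
open import Data.List
  using (List; []; _∷_; _++_; length; lookup; map; take; filter; concatMap)
open import Data.List.Extrema.Nat using (max; max≤v⁺; ⊥≤max; xs≤max)
open import Data.List.Membership.Propositional using (_∈_)
open import Data.List.Membership.Propositional.Properties
  using (∈-map⁺; ∈-map⁻; ∈-++⁺ˡ; ∈-++⁺ʳ; ∈-++⁻; ∈-filter⁺; ∈-filter⁻)
open import Data.List.Membership.Propositional.Properties.WithK using (unique∧set⇒bag)
open import Data.List.Properties
  using (length-map; length-++; filter-all; filter-none; filter-reject; ∷-injectiveʳ)
open import Data.List.Relation.Binary.BagAndSetEquality using (∼bag⇒↭)
open import Data.List.Relation.Binary.Permutation.Propositional.Properties using (↭-length)
open import Data.List.Relation.Binary.Sublist.Propositional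
  using (_⊆_; []; _∷_; _∷ʳ_; ⊆-trans; from∈; to∈)
  renaming (lookup to ⊆-lookup)
open import Data.List.Relation.Unary.All as All using (All; []; _∷_)
import Data.List.Relation.Unary.All.Properties as All
open import Data.List.Relation.Unary.AllPairs as AllPairs using (AllPairs; []; _∷_)
import Data.List.Relation.Unary.AllPairs.Properties as AllPairs
open import Data.List.Relation.Unary.Any using (here; there)
open import Data.List.Relation.Unary.Unique.Propositional using (Unique)
import Data.List.Relation.Unary.Unique.Propositional.Properties as Unique
open import Data.Maybe using (Maybe; just; nothing)
open import Data.Nat as ℕ using (ℕ; zero; suc; _≤_; _<_; _>_; _⊔_; _<?_; z≤n; s≤s)
open import Data.Nat.ListAction using (sum)
import Data.Nat.Properties as ℕ
open import Data.Product using (∃-syntax; _×_; _,_; proj₁; proj₂)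
open import Data.Rational as ℚ using (ℚ; 0ℚ; 1ℚ; ½)
import Data.Rational.Properties as ℚ
import Data.Rational.Solver as ℚ-Solver
open import Data.Rational.Unnormalised as ℚᵘ using (ℚᵘ; mkℚᵘ)
import Data.Rational.Unnormalised.Properties as ℚᵘ
open import Data.Sum using (inj₁; inj₂)
open import Function using (_∘_; _⇔_; mk⇔; Equivalence)
open import Algebra.Properties.Monoid.Sum ℚ.+-0-monoid using (sum-cong-≗)
open import Relation.Binary.Bundles using (Setoid)
open import Relation.Binary.PropositionalEquality hiding (setoid; isEquivalence)
import Relation.Binary.Reasoning.Setoid as SetoidReasoning
open import Relation.Binary.Structures using (IsEquivalence)
open import Relation.Nullary using (¬_; yes; no)

-- Restricted growth, letter by letter

-- Growth m w: the word w continues a restricted growth sequence with maximum m.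
-- The empty sequence has maximum 0.
data Growth (m : ℕ) : List ℕ → Set where
  []  : Growth m []
  _∷_ : ∀ {z w} → 1 ≤ z × z ≤ suc m → Growth (m ⊔ z) w → Growth m (z ∷ w)

max-∷ : ∀ m z w → max m (z ∷ w) ≡ max (m ⊔ z) w
max-∷ m z w = ℕ.≤-antisym
  (max≤v⁺ (ℕ.≤-trans (ℕ.m≤m⊔n m z) ⊔≤) (ℕ.≤-trans (ℕ.m≤n⊔m m z) ⊔≤ ∷ xs≤max (m ⊔ z) w))
  (max≤v⁺ (ℕ.⊔-lub (⊥≤max m (z ∷ w)) (All.head all)) (All.tail all))
  where
  ⊔≤ = ⊥≤max (m ⊔ z) w
  all = xs≤max m (z ∷ w)

Growth⇒lookup : ∀ {m w} → Growth m w →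
  ∀ i → 1 ≤ lookup w i × lookup w i ≤ suc (max m (take (toℕ i) w))
Growth⇒lookup (z≤ ∷ g) zero = z≤
Growth⇒lookup {m} {z ∷ w} (z≤ ∷ g) (suc i) with Growth⇒lookup g i
... | pos , ub = pos , subst (λ k → lookup w i ≤ suc k) (sym (max-∷ m z (take (toℕ i) w))) ub

lookup⇒Growth : ∀ {m w} →
  (∀ i → 1 ≤ lookup w i × lookup w i ≤ suc (max m (take (toℕ i) w))) → Growth m w
lookup⇒Growth {w = []}        h = []
lookup⇒Growth {m} {w = z ∷ w} h = h zero ∷ lookup⇒Growth λ i →
  proj₁ (h (suc i)) ,
  subst (λ k → lookup w i ≤ suc k) (max-∷ m z (take (toℕ i) w)) (proj₂ (h (suc i)))

IsRGS⇔Growth : ∀ w → IsRGS w ⇔ Growth 0 w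
IsRGS⇔Growth w = mk⇔ (λ r → lookup⇒Growth (bounds r)) λ g → record
  { positive = λ i → proj₁ (Growth⇒lookup g i)
  ; first    = λ i i≡0 → ℕ.≤-antisym
      (subst (λ k → lookup w i ≤ suc (max 0 (take k w))) i≡0 (proj₂ (Growth⇒lookup g i)))
      (proj₁ (Growth⇒lookup g i))
  ; growth   = λ i _ → proj₂ (Growth⇒lookup g i) }
  where
  bounds : IsRGS w → ∀ i → 1 ≤ lookup w i × lookup w i ≤ suc (max 0 (take (toℕ i) w))
  bounds r i with toℕ i in eq
  ... | zero  = IsRGS.positive r i , ℕ.≤-reflexive (IsRGS.first r i eq)
  ... | suc k = IsRGS.positive r i , subst (λ k → lookup w i ≤ suc (max 0 (take k w))) eq
                  (IsRGS.growth r i (subst (1 ≤_) (sym eq) (s≤s z≤n)))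

Growth⇒positive : ∀ {m w} → Growth m w → All (1 ≤_) w
Growth⇒positive []             = []
Growth⇒positive ((1≤z , _) ∷ g) = 1≤z ∷ Growth⇒positive g

-- Avoidance as a separation property

-- Between two occurrences of a letter c at least 3 there are only letters greater
-- than c.
Separated : List ℕ → Set
Separated w = ∀ {c x} → 3 ≤ c → x ≤ c → ¬ (c ∷ x ∷ c ∷ []) ⊆ w

module _ (f : ℕ → ℕ) (step : ∀ k → f k < f (suc k)) where

  f-mono : ∀ {i j} → i < j → f i < f j
  f-mono {i} {suc j} (s≤s i≤j) with ℕ.m≤n⇒m<n∨m≡n i≤j
  ... | inj₁ i<j  = ℕ.<-trans (f-mono i<j) (step j)
  ... | inj₂ refl = step i

  f-mono-≤ : ∀ {i j} → i ≤ j → f i ≤ f j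
  f-mono-≤ i≤j with ℕ.m≤n⇒m<n∨m≡n i≤j
  ... | inj₁ i<j  = ℕ.<⇒≤ (f-mono i<j)
  ... | inj₂ refl = ℕ.≤-refl

  f-cancel-< : ∀ {i j} → f i < f j → i < j
  f-cancel-< fi<fj = ℕ.≰⇒> λ j≤i → ℕ.<⇒≱ fi<fj (f-mono-≤ j≤i)

  f-injective : ∀ {i j} → f i ≡ f j → i ≡ j
  f-injective {i} {j} p = ℕ.≤-antisym
    (ℕ.≮⇒≥ λ j<i → ℕ.<⇒≢ (f-mono j<i) (sym p)) (ℕ.≮⇒≥ λ i<j → ℕ.<⇒≢ (f-mono i<j) p)

  lookup-map : ∀ τ .(eq : length (map f τ) ≡ length τ) i →
    lookup (map f τ) i ≡ f (lookup τ (Fin.cast eq i))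
  lookup-map (t ∷ τ) eq zero    = refl
  lookup-map (t ∷ τ) eq (suc i) = lookup-map τ (ℕ.suc-injective eq) i

  map-orderIsomorphic : ∀ τ → OrderIsomorphic (map f τ) τ
  map-orderIsomorphic τ = eq , λ i j →
    mk⇔ (λ p → f-cancel-< (subst₂ _<_ (at i) (at j) p))
        (λ p → subst₂ _<_ (sym (at i)) (sym (at j)) (f-mono p)) ,
    mk⇔ (λ p → f-injective (trans (sym (at i)) (trans p (at j))))
        (λ p → trans (at i) (trans (cong f p) (sym (at j))))
    where
    eq = length-map f τ
    at = lookup-map τ eq

-- The map fixing 0 and sending 1, 2, 3 to a, b, c.  It is defined on all of ℕ so
-- as to be strictly increasing everywhere when 0 < a < b < c.
stretch : ℕ → ℕ → ℕ → ℕ → ℕ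
stretch a b c 0 = 0
stretch a b c 1 = a
stretch a b c 2 = b
stretch a b c (suc (suc (suc k))) = k ℕ.+ c

stretch-step : ∀ {a b c} → 0 < a → a < b → b < c → ∀ k → stretch a b c k < stretch a b c (suc k)
stretch-step 0<a a<b b<c 0 = 0<a
stretch-step 0<a a<b b<c 1 = a<b
stretch-step 0<a a<b b<c 2 = b<c
stretch-step 0<a a<b b<c (suc (suc (suc k))) = ℕ.≤-refl

contains-stretched : ∀ {π a b c} τ → 0 < a → a < b → b < c →
  map (stretch a b c) τ ⊆ π → Contains π τ
contains-stretched {a = a} {b} {c} τ 0<a a<b b<c s =
  _ , s , map-orderIsomorphic (stretch a b c) (stretch-step 0<a a<b b<c) τ

-- A letter y that has not occurred yet must occur before any larger letter c.
insert-letter : ∀ {m w y c τ} → Growth m w → m < y → y < c →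
  (c ∷ τ) ⊆ w → (y ∷ c ∷ τ) ⊆ w
insert-letter ((_ , c≤1+m) ∷ g) m<y y<c (refl ∷ s) =
  ⊥-elim (ℕ.<⇒≱ (ℕ.<-≤-trans (s≤s m<y) (y<c)) c≤1+m)
insert-letter {m} {y = y} ((_ , z≤1+m) ∷ g) m<y y<c (z ∷ʳ s) with z ℕ.≟ y
... | yes refl = refl ∷ s
... | no z≢y   = z ∷ʳ insert-letter g
  (ℕ.⊔-lub m<y (ℕ.≤∧≢⇒< (ℕ.≤-trans z≤1+m m<y) z≢y)) y<c s

-- If c x c occurs with x ≤ c, then 1 2 c c c occurs for x = c, 1 2 c 1 c for x = 1
-- and 1 x c x c for 1 < x < c: the leading 1 is the first letter, and the second
-- letter is supplied by insert-letter.
avoids⇒separated : ∀ {π} → Growth 0 π → All (Avoids π) patterns → Separated π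
avoids⇒separated ((1≤z , z≤1) ∷ g) av 3≤c x≤c s
  with refl ← ℕ.≤-antisym 1≤z z≤1
  with s
... | refl ∷ _ = ℕ.<⇒≱ (s≤s (s≤s z≤n)) 3≤c
avoids⇒separated ((1≤z , z≤1) ∷ g) (av₁ ∷ av₂ ∷ av₃ ∷ []) {c} {x} 3≤c x≤c s
  | .1 ∷ʳ s′ with ℕ.m≤n⇒m<n∨m≡n x≤c
... | inj₂ refl = av₃ (contains-stretched (1 ∷ 2 ∷ 3 ∷ 3 ∷ 3 ∷ []) ℕ.≤-refl ℕ.≤-refl 3≤c
                    (refl ∷ insert-letter g ℕ.≤-refl 3≤c s′))
... | inj₁ x<c with x in eq
...   | 0 = ⊥-elim (ℕ.n≮0 (All.lookup (Growth⇒positive g) (⊆-lookup s′ (there (here refl)))))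
...   | 1 = av₁ (contains-stretched (1 ∷ 2 ∷ 3 ∷ 1 ∷ 3 ∷ []) ℕ.≤-refl ℕ.≤-refl 3≤c
                    (refl ∷ insert-letter g ℕ.≤-refl 3≤c s′))
...   | suc (suc y) = av₂ (contains-stretched (1 ∷ 2 ∷ 3 ∷ 2 ∷ 3 ∷ []) ℕ.≤-refl (s≤s (s≤s z≤n)) x<c
                    (refl ∷ insert-letter g (s≤s (s≤s z≤n)) x<c s′))

-- The last three letters c x c of an occurrence violate separation: two positive
-- letters increase up to c, so c is at least 3.
separated⇒avoids : ∀ {π} q → q ≤ 3 → All (1 ≤_) π → Separated π →
  Avoids π (1 ∷ 2 ∷ 3 ∷ q ∷ 3 ∷ [])
separated⇒avoids q q≤3 pos sep (a ∷ b ∷ c ∷ x ∷ e ∷ [] , s , refl , iso) =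
  sep 3≤c x≤c (⊆-trans (a ∷ʳ b ∷ʳ refl ∷ refl ∷ sym e≡c ∷ []) s)
  where
  e≡c : e ≡ c
  e≡c = Equivalence.from (proj₂ (iso 4F 2F)) refl
  a<b : a < b
  a<b = Equivalence.from (proj₁ (iso 0F 1F)) ℕ.≤-refl
  b<c : b < c
  b<c = Equivalence.from (proj₁ (iso 1F 2F)) ℕ.≤-refl
  3≤c : 3 ≤ c
  3≤c = ℕ.≤-trans (s≤s (ℕ.≤-trans (s≤s (All.lookup pos (⊆-lookup s (here refl)))) a<b)) b<c
  x≤c : x ≤ c
  x≤c = ℕ.≮⇒≥ λ c<x → ℕ.<⇒≱ (Equivalence.to (proj₁ (iso 2F 3F)) c<x) q≤3

avoids⇔separated : ∀ {π} → Growth 0 π → All (Avoids π) patterns ⇔ Separated π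
avoids⇔separated g = mk⇔ (avoids⇒separated g) λ sep →
  separated⇒avoids 1 (s≤s z≤n) pos sep ∷
  separated⇒avoids 2 (s≤s (s≤s z≤n)) pos sep ∷
  separated⇒avoids 3 ℕ.≤-refl pos sep ∷ []
  where pos = Growth⇒positive g

-- Reading a word with a stack of reusable letters

-- The words w that may follow a prefix with maximum m and stack st.  A letter c
-- that is at least 3 and at most m has occurred in the prefix, so it may only occur
-- in w if it is on the stack, and then with no letter x ≤ c before it in w.
record Admissible (m : ℕ) (st w : List ℕ) : Set where
  field
    growing   : Growth m w
    separated : Separated w
    reusable  : ∀ {c} → 3 ≤ c → c ≤ m → c ∈ w → c ∈ st
    unblocked : ∀ {c x} → 3 ≤ c → c ≤ m → x ≤ c → ¬ (x ∷ c ∷ []) ⊆ w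

open Admissible

-- The stack left after reading a letter z ≤ m.
below : ℕ → List ℕ → List ℕ
below z = filter (_<? z)

-- The stack left after reading the new letter m + 1.  The letters 1 and 2 are
-- never on the stack.
push : ℕ → List ℕ → List ℕ
push (suc (suc m)) st = suc (suc (suc m)) ∷ st
push _             st = st

-- Those among the letters 1 and 2 that are at most m.
smallLetters : ℕ → List ℕ
smallLetters 0 = []
smallLetters 1 = 1 ∷ []
smallLetters (suc (suc m)) = 1 ∷ 2 ∷ []

∈-smallLetters : ∀ {m z} → 1 ≤ z → z ≤ 2 → z ≤ m → z ∈ smallLetters m
∈-smallLetters {1} (s≤s z≤n) z≤2 (s≤s z≤n) = here refl
∈-smallLetters {suc (suc m)} {1} _ _ _ = here refl
∈-smallLetters {suc (suc m)} {2} _ _ _ = there (here refl)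
∈-smallLetters {suc (suc m)} {suc (suc (suc z))} _ (s≤s (s≤s ())) _

smallLetters-bounds : ∀ m → All (λ z → 1 ≤ z × z ≤ 2 × z ≤ m) (smallLetters m)
smallLetters-bounds 0 = []
smallLetters-bounds 1 = (s≤s z≤n , s≤s z≤n , s≤s z≤n) ∷ []
smallLetters-bounds (suc (suc m)) =
  (s≤s z≤n , s≤s z≤n , s≤s z≤n) ∷ (s≤s z≤n , s≤s (s≤s z≤n) , s≤s (s≤s z≤n)) ∷ []

∈-push⁺ : ∀ {m st} → 3 ≤ suc m → suc m ∈ push m st
∈-push⁺ {0} (s≤s ())
∈-push⁺ {suc (suc m)} _ = here refl
∈-push⁺ {1} (s≤s (s≤s ()))

⊆-push : ∀ m {st c} → c ∈ st → c ∈ push m st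
⊆-push 0 = λ p → p
⊆-push 1 = λ p → p
⊆-push (suc (suc m)) = there

∈-push⁻ : ∀ m {st c} → c ≤ m → c ∈ push m st → c ∈ st
∈-push⁻ 0 _ p = p
∈-push⁻ 1 _ p = p
∈-push⁻ (suc (suc m)) c≤m (here refl) = ⊥-elim (ℕ.1+n≰n c≤m)
∈-push⁻ (suc (suc m)) c≤m (there p) = p

-- The invariant of the stack st when the maximum is m.  The head is the largest
-- letter.
Stack : ℕ → List ℕ → Set
Stack m st = All (λ c → 3 ≤ c × c ≤ m) st × AllPairs _>_ st

Stack-push : ∀ m {st} → Stack m st → Stack (suc m) (push m st)
Stack-push 0 (bs , ds) = All.map (λ (p , q) → p , ℕ.m≤n⇒m≤1+n q) bs , ds
Stack-push 1 (bs , ds) = All.map (λ (p , q) → p , ℕ.m≤n⇒m≤1+n q) bs , ds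
Stack-push (suc (suc m)) (bs , ds) =
  (s≤s (s≤s (s≤s z≤n)) , ℕ.≤-refl) ∷ All.map (λ (p , q) → p , ℕ.m≤n⇒m≤1+n q) bs ,
  All.map (s≤s ∘ proj₂) bs ∷ ds

Stack-below : ∀ {m st} z → Stack m st → Stack m (below z st)
Stack-below z (bs , ds) = All.filter⁺ (_<? z) bs , AllPairs.filter⁺ (_<? z) ds

-- A new letter that is at least 3 may occur at most once more, and not after a
-- smaller letter, by separation.
admissible-new : ∀ m st w →
  Admissible m st (suc m ∷ w) ⇔ Admissible (suc m) (push m st) w
admissible-new m st w = mk⇔ to from
  where
  ⊔≡ : m ⊔ suc m ≡ suc m
  ⊔≡ = ℕ.m≤n⇒m⊔n≡n (ℕ.n≤1+n m)
  to : Admissible m st (suc m ∷ w) → Admissible (suc m) (push m st) w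
  to a .growing with _ ∷ g ← growing a = subst (λ k → Growth k w) ⊔≡ g
  to a .separated 3≤c x≤c s = separated a 3≤c x≤c (suc m ∷ʳ s)
  to a .reusable 3≤c c≤1+m c∈w with ℕ.m≤n⇒m<n∨m≡n c≤1+m
  ... | inj₁ (s≤s c≤m) = ⊆-push m (reusable a 3≤c c≤m (there c∈w))
  ... | inj₂ refl      = ∈-push⁺ 3≤c
  to a .unblocked 3≤c c≤1+m x≤c s with ℕ.m≤n⇒m<n∨m≡n c≤1+m
  ... | inj₁ (s≤s c≤m) = unblocked a 3≤c c≤m x≤c (suc m ∷ʳ s)
  ... | inj₂ refl      = separated a 3≤c x≤c (refl ∷ s)
  from : Admissible (suc m) (push m st) w → Admissible m st (suc m ∷ w)
  from a .growing = (s≤s z≤n , ℕ.≤-refl) ∷ subst (λ k → Growth k w) (sym ⊔≡) (growing a)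
  from a .separated 3≤c x≤c (_ ∷ʳ s)   = separated a 3≤c x≤c s
  from a .separated 3≤c x≤c (refl ∷ s) = unblocked a 3≤c ℕ.≤-refl x≤c s
  from a .reusable 3≤c c≤m (here refl) = ⊥-elim (ℕ.1+n≰n c≤m)
  from a .reusable 3≤c c≤m (there c∈w) = ∈-push⁻ m c≤m (reusable a 3≤c (ℕ.m≤n⇒m≤1+n c≤m) c∈w)
  from a .unblocked 3≤c c≤m x≤c (_ ∷ʳ s)   = unblocked a 3≤c (ℕ.m≤n⇒m≤1+n c≤m) x≤c s
  from a .unblocked 3≤c c≤m x≤c (refl ∷ s) = ℕ.1+n≰n (ℕ.≤-trans x≤c c≤m)

-- Reading an old letter z: no letter of the stack that is at least z may occur
-- afterwards, and z itself is small or on the stack.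
admissible-old : ∀ {m st} z w → Stack m st → z ≤ m →
  Admissible m st (z ∷ w) ⇔ (z ∈ smallLetters m ++ st × Admissible m (below z st) w)
admissible-old {m} {st} z w (bs , ds) z≤m = mk⇔ (λ a → letter a , to a) from
  where
  ⊔≡ : m ⊔ z ≡ m
  ⊔≡ = ℕ.m≥n⇒m⊔n≡m z≤m
  letter : Admissible m st (z ∷ w) → z ∈ smallLetters m ++ st
  letter a with z ℕ.≤? 2
  ... | yes z≤2 with (1≤z , _) ∷ _ ← growing a = ∈-++⁺ˡ (∈-smallLetters 1≤z z≤2 z≤m)
  ... | no z≰2 = ∈-++⁺ʳ (smallLetters m) (reusable a (ℕ.≰⇒> z≰2) z≤m (here refl))
  to : Admissible m st (z ∷ w) → Admissible m (below z st) w
  to a .growing with _ ∷ g ← growing a = subst (λ k → Growth k w) ⊔≡ g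
  to a .separated 3≤c x≤c s = separated a 3≤c x≤c (z ∷ʳ s)
  to a .reusable 3≤c c≤m c∈w = ∈-filter⁺ (_<? z) (reusable a 3≤c c≤m (there c∈w))
    (ℕ.≰⇒> λ z≤c → unblocked a 3≤c c≤m z≤c (refl ∷ from∈ c∈w))
  to a .unblocked 3≤c c≤m x≤c s = unblocked a 3≤c c≤m x≤c (z ∷ʳ s)
  from : z ∈ smallLetters m ++ st × Admissible m (below z st) w → Admissible m st (z ∷ w)
  from (z∈ , a) = record
    { growing   = (1≤z , ℕ.m≤n⇒m≤1+n z≤m) ∷ subst (λ k → Growth k w) (sym ⊔≡) (growing a)
    ; separated = λ where
        3≤c x≤c (_ ∷ʳ s)   → separated a 3≤c x≤c s
        3≤c x≤c (refl ∷ s) → unblocked a 3≤c z≤m x≤c s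
    ; reusable  = λ where
        3≤c c≤m (here refl) → large 3≤c
        3≤c c≤m (there c∈w) → proj₁ (∈-filter⁻ (_<? z) (reusable a 3≤c c≤m c∈w))
    ; unblocked = λ where
        3≤c c≤m x≤c (_ ∷ʳ s)   → unblocked a 3≤c c≤m x≤c s
        3≤c c≤m x≤c (refl ∷ s) → ℕ.<⇒≱
          (proj₂ (∈-filter⁻ (_<? z) {xs = st} (reusable a 3≤c c≤m (to∈ s)))) x≤c }
    where
    1≤z : 1 ≤ z
    1≤z with ∈-++⁻ (smallLetters m) z∈
    ... | inj₁ p = proj₁ (All.lookup (smallLetters-bounds m) p)
    ... | inj₂ p = ℕ.≤-trans (s≤s z≤n) (proj₁ (All.lookup bs p))
    large : 3 ≤ z → z ∈ st
    large 3≤z with ∈-++⁻ (smallLetters m) z∈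
    ... | inj₁ p = ⊥-elim (ℕ.<⇒≱ 3≤z (proj₁ (proj₂ (All.lookup (smallLetters-bounds m) p))))
    ... | inj₂ p = p

-- Enumerating the admissible words

-- All words formed by a letter z of the given list and a word of F z.
prefixed : (ℕ → List (List ℕ)) → List ℕ → List (List ℕ)
prefixed F = concatMap λ z → map (z ∷_) (F z)

∈-prefixed⁺ : ∀ F {zs z w} → z ∈ zs → w ∈ F z → z ∷ w ∈ prefixed F zs
∈-prefixed⁺ F (here refl)             w∈ = ∈-++⁺ˡ (∈-map⁺ _ w∈)
∈-prefixed⁺ F {y ∷ zs} (there z∈) w∈ = ∈-++⁺ʳ (map (y ∷_) (F y)) (∈-prefixed⁺ F z∈ w∈)

∈-prefixed⁻ : ∀ F zs {v} → v ∈ prefixed F zs → ∃[ z ] ∃[ w ] v ≡ z ∷ w × z ∈ zs × w ∈ F z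
∈-prefixed⁻ F (y ∷ zs) v∈ with ∈-++⁻ (map (y ∷_) (F y)) v∈
... | inj₁ v∈ˡ with w , w∈ , eq ← ∈-map⁻ (y ∷_) v∈ˡ = y , w , eq , here refl , w∈
... | inj₂ v∈ʳ with z , w , eq , z∈ , w∈ ← ∈-prefixed⁻ F zs v∈ʳ = z , w , eq , there z∈ , w∈

prefixed-unique : ∀ F {zs} → Unique zs → (∀ {z} → z ∈ zs → Unique (F z)) → Unique (prefixed F zs)
prefixed-unique F []         u = []
prefixed-unique F {y ∷ zs} (y∉ ∷ us) u = Unique.++⁺
  (Unique.map⁺ ∷-injectiveʳ (u (here refl)))
  (prefixed-unique F us (u ∘ there))
  λ (v∈ˡ , v∈ʳ) → disjoint v∈ˡ v∈ʳ
  where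
  disjoint : ∀ {v} → v ∈ map (y ∷_) (F y) → ¬ v ∈ prefixed F zs
  disjoint v∈ˡ v∈ʳ with _ , _ , refl ← ∈-map⁻ (y ∷_) v∈ˡ
                   with _ , _ , refl , y∈ , _ ← ∈-prefixed⁻ F zs v∈ʳ = All.lookup y∉ y∈ refl

-- The admissible words of length n for the maximum m and the stack st.
admissibleWords : ℕ → ℕ → List ℕ → List (List ℕ)
admissibleWords zero    m st = [] ∷ []
admissibleWords (suc n) m st =
  map (suc m ∷_) (admissibleWords n (suc m) (push m st)) ++
  prefixed (λ z → admissibleWords n m (below z st)) (smallLetters m ++ st)

oldLetter≤ : ∀ {m st} → Stack m st → All (_≤ m) (smallLetters m ++ st)
oldLetter≤ {m} (bs , _) =
  All.++⁺ (All.map (proj₂ ∘ proj₂) (smallLetters-bounds m)) (All.map proj₂ bs)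

∈-admissibleWords⁻ : ∀ n {m st w} → Stack m st → w ∈ admissibleWords n m st →
  length w ≡ n × Admissible m st w
∈-admissibleWords⁻ zero σ (here refl) = refl , record
  { growing = [] ; separated = λ _ _ () ; reusable = λ _ _ () ; unblocked = λ _ _ _ () }
∈-admissibleWords⁻ (suc n) {m} {st} σ w∈
  with ∈-++⁻ (map (suc m ∷_) (admissibleWords n (suc m) (push m st))) w∈
... | inj₁ w∈ˡ with w , w∈ , refl ← ∈-map⁻ (suc m ∷_) w∈ˡ
               with len , a ← ∈-admissibleWords⁻ n (Stack-push m σ) w∈ =
  cong suc len , Equivalence.from (admissible-new m st w) a
... | inj₂ w∈ʳ with z , w , refl , z∈ , w∈ ← ∈-prefixed⁻
                      (λ z → admissibleWords n m (below z st)) (smallLetters m ++ st) w∈ʳ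
               with len , a ← ∈-admissibleWords⁻ n (Stack-below z σ) w∈ =
  cong suc len , Equivalence.from (admissible-old z w σ (All.lookup (oldLetter≤ σ) z∈)) (z∈ , a)

∈-admissibleWords⁺ : ∀ {m st} w → Stack m st → Admissible m st w →
  w ∈ admissibleWords (length w) m st
∈-admissibleWords⁺ []      σ a = here refl
∈-admissibleWords⁺ {m} {st} (z ∷ w) σ a with growing a
... | (_ , z≤1+m) ∷ _ with ℕ.m≤n⇒m<n∨m≡n z≤1+m
...   | inj₂ refl = ∈-++⁺ˡ (∈-map⁺ (suc m ∷_)
          (∈-admissibleWords⁺ w (Stack-push m σ) (Equivalence.to (admissible-new m st w) a)))
...   | inj₁ (s≤s z≤m) with z∈ , a′ ← Equivalence.to (admissible-old z w σ z≤m) a =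
          ∈-++⁺ʳ (map (suc m ∷_) (admissibleWords (length w) (suc m) (push m st)))
            (∈-prefixed⁺ (λ z → admissibleWords (length w) m (below z st)) z∈
              (∈-admissibleWords⁺ w (Stack-below z σ) a′))

smallLetters-unique : ∀ m → Unique (smallLetters m)
smallLetters-unique 0 = []
smallLetters-unique 1 = [] ∷ []
smallLetters-unique (suc (suc m)) = ((λ ()) ∷ []) ∷ [] ∷ []

admissibleWords-unique : ∀ n {m st} → Stack m st → Unique (admissibleWords n m st)
admissibleWords-unique zero    σ = [] ∷ []
admissibleWords-unique (suc n) {m} {st} σ@(bs , ds) = Unique.++⁺
  (Unique.map⁺ ∷-injectiveʳ (admissibleWords-unique n (Stack-push m σ)))
  (prefixed-unique _ letters-unique (λ {z} _ → admissibleWords-unique n (Stack-below z σ)))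
  λ (v∈ˡ , v∈ʳ) → disjoint v∈ˡ v∈ʳ
  where
  letters-unique : Unique (smallLetters m ++ st)
  letters-unique = Unique.++⁺ (smallLetters-unique m) (AllPairs.map ℕ.>⇒≢ ds)
    λ (z∈ˡ , z∈ʳ) → ℕ.<⇒≱ (proj₁ (All.lookup bs z∈ʳ))
                           (proj₁ (proj₂ (All.lookup (smallLetters-bounds m) z∈ˡ)))
  disjoint : ∀ {v} → v ∈ map (suc m ∷_) (admissibleWords n (suc m) (push m st)) →
    ¬ v ∈ prefixed (λ z → admissibleWords n m (below z st)) (smallLetters m ++ st)
  disjoint v∈ˡ v∈ʳ with _ , _ , refl ← ∈-map⁻ (suc m ∷_) v∈ˡ
                   with _ , _ , refl , z∈ , _ ← ∈-prefixed⁻ _ (smallLetters m ++ st) v∈ʳ =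
    ℕ.1+n≰n (All.lookup (oldLetter≤ σ) z∈)

-- Counting the completions

-- a 0 + ... + a (h - 1)
sumBelow : (ℕ → ℕ) → ℕ → ℕ
sumBelow a zero    = 0
sumBelow a (suc h) = a h ℕ.+ sumBelow a h

-- The number of admissible words of length n for a stack of height h, when 1 and 2
-- have occurred.  The three summands count the words starting with a new letter,
-- with 1 or 2, and with a letter of the stack.
completions : ℕ → ℕ → ℕ
completions zero    h = 1
completions (suc n) h =
  completions n (suc h) ℕ.+ (2 ℕ.* completions n 0 ℕ.+ sumBelow (completions n) h)

-- The same for the maximum 1, where the prefix is a block of ones.
completionsOfOnes : ℕ → ℕ
completionsOfOnes zero    = 1
completionsOfOnes (suc n) = completions n 0 ℕ.+ completionsOfOnes n

-- The same for the empty prefix.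
total : ℕ → ℕ
total zero    = 1
total (suc n) = completionsOfOnes n

length-prefixed : ∀ F zs → length (prefixed F zs) ≡ sum (map (length ∘ F) zs)
length-prefixed F []       = refl
length-prefixed F (z ∷ zs) = trans (length-++ (map (z ∷_) (F z)))
  (cong₂ ℕ._+_ (length-map (z ∷_) (F z)) (length-prefixed F zs))

-- Reading the letters of the stack leaves stacks of heights 0, ..., h - 1, each
-- exactly once.
sum-below : ∀ a f st → AllPairs _>_ st → All (λ z → f z ≡ a (length (below z st))) st →
  sum (map f st) ≡ sumBelow a (length st)
sum-below a f []       []         []       = refl
sum-below a f (c ∷ st) (c> ∷ ds) (fc ∷ fs) = cong₂ ℕ._+_
  (trans fc (cong (a ∘ length) below-top))
  (sum-below a f st ds (All.zipWith (λ {z} (c>z , fz) →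
    trans fz (cong (a ∘ length) (filter-reject (_<? z) (ℕ.<⇒≯ c>z)))) (c> , fs)))
  where
  below-top : below c (c ∷ st) ≡ st
  below-top = trans (filter-reject (_<? c) (ℕ.<-irrefl refl)) (filter-all (_<? c) c>)

length-admissibleWords : ∀ n m st → Stack (2 ℕ.+ m) st →
  length (admissibleWords n (2 ℕ.+ m) st) ≡ completions n (length st)
length-admissibleWords zero    m st σ = refl
length-admissibleWords (suc n) m st σ@(bs , ds) = begin
  length (map (3 ℕ.+ m ∷_) pushed ++ prefixed F (1 ∷ 2 ∷ st))
    ≡⟨ length-++ (map (3 ℕ.+ m ∷_) pushed) ⟩
  length (map (3 ℕ.+ m ∷_) pushed) ℕ.+ length (prefixed F (1 ∷ 2 ∷ st))
    ≡⟨ cong₂ ℕ._+_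
         (trans (length-map (3 ℕ.+ m ∷_) pushed)
           (length-admissibleWords n (suc m) (3 ℕ.+ m ∷ st) (Stack-push (2 ℕ.+ m) σ)))
         (length-prefixed F (1 ∷ 2 ∷ st)) ⟩
  b ℕ.+ (length (F 1) ℕ.+ (length (F 2) ℕ.+ sum (map (length ∘ F) st)))
    ≡⟨ cong (b ℕ.+_) (cong₂ ℕ._+_ (small 1 (s≤s z≤n)) (cong₂ ℕ._+_ (small 2 (s≤s (s≤s z≤n)))
         (sum-below (completions n) (length ∘ F) st ds (All.tabulate λ {z} _ → length-F z)))) ⟩
  b ℕ.+ (a ℕ.+ (a ℕ.+ sumBelow (completions n) (length st)))
    ≡⟨ cong (b ℕ.+_) (trans (sym (ℕ.+-assoc a a _))
         (cong (λ k → a ℕ.+ k ℕ.+ sumBelow (completions n) (length st)) (sym (ℕ.+-identityʳ a)))) ⟩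
  completions (suc n) (length st) ∎
  where
  open ≡-Reasoning
  a b : ℕ
  a = completions n 0
  b = completions n (suc (length st))
  pushed : List (List ℕ)
  pushed = admissibleWords n (3 ℕ.+ m) (3 ℕ.+ m ∷ st)
  F : ℕ → List (List ℕ)
  F z = admissibleWords n (2 ℕ.+ m) (below z st)
  length-F : ∀ z → length (F z) ≡ completions n (length (below z st))
  length-F z = length-admissibleWords n m (below z st) (Stack-below z σ)
  small : ∀ z → z ≤ 2 → length (F z) ≡ completions n 0
  small z z≤2 = trans (length-F z) (cong (completions n ∘ length)
    (filter-none (_<? z) (All.map (λ (3≤c , _) → ℕ.≤⇒≯ (ℕ.≤-trans z≤2 (ℕ.<⇒≤ 3≤c))) bs)))

length-admissibleWords₁ : ∀ n → length (admissibleWords n 1 []) ≡ completionsOfOnes n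
length-admissibleWords₁ zero    = refl
length-admissibleWords₁ (suc n) = trans (length-++ (map (2 ∷_) (admissibleWords n 2 [])))
  (cong₂ ℕ._+_
    (trans (length-map (2 ∷_) (admissibleWords n 2 [])) (length-admissibleWords n 0 [] ([] , [])))
    (trans (length-prefixed (λ _ → admissibleWords n 1 []) (1 ∷ []))
      (trans (ℕ.+-identityʳ _) (length-admissibleWords₁ n))))

length-admissibleWords₀ : ∀ n → length (admissibleWords n 0 []) ≡ total n
length-admissibleWords₀ zero    = refl
length-admissibleWords₀ (suc n) = trans (length-++ (map (1 ∷_) (admissibleWords n 1 [])))
  (trans (ℕ.+-identityʳ _)
    (trans (length-map (1 ∷_) (admissibleWords n 1 [])) (length-admissibleWords₁ n)))

𝒫⇔admissible : ∀ n w → 𝒫 n patterns w ⇔ (length w ≡ n × Admissible 0 [] w)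
𝒫⇔admissible n w = mk⇔
  (λ (len , r , av) → let g = Equivalence.to (IsRGS⇔Growth w) r in len , record
    { growing   = g
    ; separated = Equivalence.to (avoids⇔separated g) av
    ; reusable  = λ 3≤c c≤0 _ → ⊥-elim (ℕ.n≮0 (ℕ.≤-trans 3≤c c≤0))
    ; unblocked = λ 3≤c c≤0 _ _ → ℕ.n≮0 (ℕ.≤-trans 3≤c c≤0) })
  (λ (len , a) → len , Equivalence.from (IsRGS⇔Growth w) (growing a)
                     , Equivalence.from (avoids⇔separated (growing a)) (separated a))

∣𝒫∣≡total : ∀ n → ∣𝒫∣ n patterns ≡ total n
∣𝒫∣≡total n = trans (↭-length (∼bag⇒↭ (unique∧set⇒bag (list𝒫-unique n patterns)
  (admissibleWords-unique n ([] , [])) same))) (length-admissibleWords₀ n)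
  where
  same : ∀ {w} → w ∈ list𝒫 n patterns ⇔ w ∈ admissibleWords n 0 []
  same {w} = mk⇔
    (λ w∈ → included (Equivalence.to (𝒫⇔admissible n w)
      (Equivalence.to (∈-list𝒫 n patterns w) w∈)))
    (λ w∈ → Equivalence.from (∈-list𝒫 n patterns w)
      (Equivalence.from (𝒫⇔admissible n w) (∈-admissibleWords⁻ n ([] , []) w∈)))
    where
    included : length w ≡ n × Admissible 0 [] w → w ∈ admissibleWords n 0 []
    included (refl , a) = ∈-admissibleWords⁺ w ([] , []) a

-- The ring of formal power series

-- The constant series.
const : ℚ → PowerSeries
const = monomial 0

infix 8 -_
-_ : PowerSeries → PowerSeries
(- f) n = ℚ.- f n

-- The series without its constant coefficient, divided by x.
tail : PowerSeries → PowerSeries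
tail f n = f (suc n)

-- Multiplication of all coefficients by a rational number.
scale : ℚ → PowerSeries → PowerSeries
scale c f n = c ℚ.* f n

module _ where
  open ℚ-Solver.+-*-Solver

  *-distribʳ-+ : ∀ h f g → (f + g) * h ≈ f * h + g * h
  *-distribʳ-+ h f g zero =
    solve 3 (λ f g h → (f :+ g) :* h :+ con 0ℚ := (f :* h :+ con 0ℚ) :+ (g :* h :+ con 0ℚ))
      refl (f 0) (g 0) (h 0)
  *-distribʳ-+ h f g (suc n) rewrite *-distribʳ-+ h (tail f) (tail g) n =
    solve 5 (λ f g h u v → (f :+ g) :* h :+ (u :+ v) := (f :* h :+ u) :+ (g :* h :+ v))
      refl (f 0) (g 0) (h (suc n)) ((tail f * h) n) ((tail g * h) n)

  scale-* : ∀ c f g → scale c f * g ≈ scale c (f * g)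
  scale-* c f g zero =
    solve 3 (λ c f g → (c :* f) :* g :+ con 0ℚ := c :* (f :* g :+ con 0ℚ))
      refl c (f 0) (g 0)
  scale-* c f g (suc n) rewrite scale-* c (tail f) g n =
    solve 4 (λ c f g u → (c :* f) :* g :+ c :* u := c :* (f :* g :+ u))
      refl c (f 0) (g (suc n)) ((tail f * g) n)

  *-assoc : ∀ f g h → (f * g) * h ≈ f * (g * h)
  *-assoc f g h zero =
    solve 3 (λ f g h → (f :* g :+ con 0ℚ) :* h :+ con 0ℚ := f :* (g :* h :+ con 0ℚ) :+ con 0ℚ)
      refl (f 0) (g 0) (h 0)
  *-assoc f g h (suc n)
    rewrite *-distribʳ-+ h (scale (f 0) (tail g)) (tail f * g) n
          | scale-* (f 0) (tail g) h n | *-assoc (tail f) g h n =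
    solve 5 (λ f g h u v → (f :* g :+ con 0ℚ) :* h :+ (f :* u :+ v) := f :* (g :* h :+ u) :+ v)
      refl (f 0) (g 0) (h (suc n)) ((tail g * h) n) ((tail f * (g * h)) n)

  -- The defining recursion of the product peels off the constant term of the
  -- first factor; this is the mirror image.
  *-sucʳ : ∀ f g n → (f * g) (suc n) ≡ (f * tail g) n ℚ.+ f (suc n) ℚ.* g 0
  *-sucʳ f g zero =
    solve 4 (λ f0 f1 g0 g1 → f0 :* g1 :+ (f1 :* g0 :+ con 0ℚ) := (f0 :* g1 :+ con 0ℚ) :+ f1 :* g0)
      refl (f 0) (f 1) (g 0) (g 1)
  *-sucʳ f g (suc n) =
    trans (cong (f 0 ℚ.* g (suc (suc n)) ℚ.+_) (*-sucʳ (tail f) g n))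
          (sym (ℚ.+-assoc (f 0 ℚ.* g (suc (suc n))) ((tail f * tail g) n)
            (f (suc (suc n)) ℚ.* g 0)))

  *-comm : ∀ f g → f * g ≈ g * f
  *-comm f g zero = cong (ℚ._+ 0ℚ) (ℚ.*-comm (f 0) (g 0))
  *-comm f g (suc n) rewrite *-sucʳ g f n | *-comm (tail f) g n =
    solve 3 (λ f g u → f :* g :+ u := u :+ g :* f) refl (f 0) (g (suc n)) ((g * tail f) n)

*-cong : ∀ {f f′ g g′} → f ≈ f′ → g ≈ g′ → f * g ≈ f′ * g′
*-cong p q n = sum-cong-≗ {suc n} λ k → cong₂ ℚ._*_ (p (toℕ k)) (q (n ℕ.∸ toℕ k))

*-congˡ : ∀ f {g g′} → g ≈ g′ → f * g ≈ f * g′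
*-congˡ f p = *-cong {f} {f} (λ _ → refl) p

*-congʳ : ∀ g {f f′} → f ≈ f′ → f * g ≈ f′ * g
*-congʳ g {f} {f′} p = *-cong {f} {f′} {g} {g} p (λ _ → refl)

+-congˡ : ∀ f {g g′} → g ≈ g′ → f + g ≈ f + g′
+-congˡ f p n = cong (f n ℚ.+_) (p n)

-‿congˡ : ∀ f {g g′} → g ≈ g′ → f - g ≈ f - g′
-‿congˡ f p n = cong (λ c → f n ℚ.- c) (p n)

*-zeroˡ : ∀ f → const 0ℚ * f ≈ const 0ℚ
*-zeroˡ f zero    = trans (ℚ.+-identityʳ _) (ℚ.*-zeroˡ (f 0))
*-zeroˡ f (suc n) = begin
  0ℚ ℚ.* f (suc n) ℚ.+ (tail (const 0ℚ) * f) n ≡⟨ cong₂ ℚ._+_ (ℚ.*-zeroˡ (f (suc n))) (zeros f n) ⟩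
  0ℚ ∎
  where
  open ≡-Reasoning
  zeros : ∀ f n → (tail (const 0ℚ) * f) n ≡ 0ℚ
  zeros f zero    = trans (ℚ.+-identityʳ _) (ℚ.*-zeroˡ (f 0))
  zeros f (suc n) = cong₂ ℚ._+_ (ℚ.*-zeroˡ (f (suc n))) (zeros f n)

const-0 : ∀ n → const 0ℚ n ≡ 0ℚ
const-0 zero    = refl
const-0 (suc n) = refl

const-* : ∀ c f → const c * f ≈ scale c f
const-* c f zero    = ℚ.+-identityʳ _
const-* c f (suc n) = trans
  (cong (c ℚ.* f (suc n) ℚ.+_)
    (trans (*-cong {tail (const c)} {const 0ℚ} {f} {f} (λ k → sym (const-0 k)) (λ _ → refl) n)
           (trans (*-zeroˡ f n) (const-0 n))))
  (ℚ.+-identityʳ _)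

ring : CommutativeRing _ _
ring = record
  { Carrier = PowerSeries ; _≈_ = _≈_ ; _+_ = _+_ ; _*_ = _*_ ; -_ = -_
  ; 0# = const 0ℚ ; 1# = C 1
  ; isCommutativeRing = record
    { isRing = record
      { +-isAbelianGroup = record
        { isGroup = record
          { isMonoid = record
            { isSemigroup = record
              { isMagma = record
                { isEquivalence = isEquivalence
                ; ∙-cong = λ p q n → cong₂ ℚ._+_ (p n) (q n) }
              ; assoc = λ f g h n → ℚ.+-assoc (f n) (g n) (h n) }
            ; identity = (λ f n → trans (cong (ℚ._+ f n) (const-0 n)) (ℚ.+-identityˡ (f n)))
                       , (λ f n → trans (cong (f n ℚ.+_) (const-0 n)) (ℚ.+-identityʳ (f n))) }
          ; inverse = (λ f n → trans (ℚ.+-inverseˡ (f n)) (sym (const-0 n)))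
                    , (λ f n → trans (ℚ.+-inverseʳ (f n)) (sym (const-0 n)))
          ; ⁻¹-cong = λ p n → cong ℚ.-_ (p n) }
        ; comm = λ f g n → ℚ.+-comm (f n) (g n) }
      ; *-cong = *-cong
      ; *-assoc = *-assoc
      ; *-identity = comm∧idˡ⇒id setoid *-comm
          (λ f n → trans (const-* 1ℚ f n) (ℚ.*-identityˡ (f n)))
      ; distrib = comm∧distrʳ⇒distr setoid (λ p q n → cong₂ ℚ._+_ (p n) (q n)) *-comm *-distribʳ-+ }
    ; *-comm = *-comm } }
  where
  isEquivalence : IsEquivalence _≈_
  isEquivalence = record { refl = λ _ → refl ; sym = λ p n → sym (p n)
                         ; trans = λ p q n → trans (p n) (q n) }
  setoid : Setoid _ _
  setoid = record { isEquivalence = isEquivalence }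

module R = CommutativeRing ring

-- Rational constants serve as the coefficients of the ring solver.
const-homomorphism :
  CommutativeRing.rawRing ℚ.+-*-commutativeRing -Raw-AlmostCommutative⟶ fromCommutativeRing ring
const-homomorphism = record
  { ⟦_⟧    = const
  ; +-homo = λ { c d zero → refl ; c d (suc n) → refl }
  ; *-homo = λ { c d zero → sym (const-* c (const d) zero)
               ; c d (suc n) → sym (trans (const-* c (const d) (suc n)) (ℚ.*-zeroʳ c)) }
  ; -‿homo = λ { c zero → refl ; c (suc n) → refl }
  ; 0-homo = λ _ → refl
  ; 1-homo = λ _ → refl
  }

const≟ : ∀ c d → Maybe (const c ≈ const d)
const≟ c d with c ℚ.≟ d
... | yes c≡d = just λ n → cong (λ c → const c n) c≡d
... | no _    = nothing

open RingSolver _ _ const-homomorphism const≟ using (Polynomial; solve; con; _:=_; _:+_; _:*_; _:-_)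

-- The numeral k in a solver expression.
nat : ∀ {n} → ℕ → Polynomial n
nat k = con (fromℕ k)

X*-suc : ∀ f n → (X * f) (suc n) ≡ f n
X*-suc f n = begin
  0ℚ ℚ.* f (suc n) ℚ.+ (tail X * f) n ≡⟨ cong₂ ℚ._+_ (ℚ.*-zeroˡ (f (suc n))) (*-congʳ f tail-X n) ⟩
  0ℚ ℚ.+ (C 1 * f) n                  ≡⟨ ℚ.+-identityˡ _ ⟩
  (C 1 * f) n                         ≡⟨ R.*-identityˡ f n ⟩
  f n                                 ∎
  where
  open ≡-Reasoning
  tail-X : tail X ≈ C 1
  tail-X zero    = refl
  tail-X (suc n) = refl

X*-zero : ∀ f → (X * f) 0 ≡ 0ℚ
X*-zero f = trans (ℚ.+-identityʳ _) (ℚ.*-zeroˡ (f 0))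

X*-cancel : ∀ {f g} → X * f ≈ X * g → f ≈ g
X*-cancel {f} {g} p n = trans (sym (X*-suc f n)) (trans (p (suc n)) (X*-suc g n))

-- Long division returns the only possible quotient.
/-unique : ∀ f g h .{{_ : ℚ.NonZero (g 0)}} → f * g ≈ h → f ≈ h / g
/-unique f g h p zero = begin
  f 0                          ≡⟨ ℚ.*-identityʳ (f 0) ⟨
  f 0 ℚ.* 1ℚ                   ≡⟨ cong (f 0 ℚ.*_) (ℚ.*-inverseʳ (g 0)) ⟨
  f 0 ℚ.* (g 0 ℚ.* ℚ.1/ g 0)   ≡⟨ ℚ.*-assoc (f 0) (g 0) _ ⟨
  (f 0 ℚ.* g 0) ℚ.* ℚ.1/ g 0   ≡⟨ cong (ℚ._* ℚ.1/ g 0)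
                                    (trans (sym (ℚ.+-identityʳ (f 0 ℚ.* g 0))) (p 0)) ⟩
  h 0 ℚ.÷ g 0                  ∎
  where open ≡-Reasoning
/-unique f g h p (suc n) = /-unique (tail f) g _ quotient n
  where
  open ≡-Reasoning
  open ℚ-Solver.+-*-Solver renaming (solve to ℚsolve; _:=_ to _:≡_; _:+_ to _:⊕_; _:-_ to _:⊖_)
  quotient : tail f * g ≈ λ k → h (suc k) ℚ.- (h 0 ℚ.÷ g 0) ℚ.* g (suc k)
  quotient k = begin
    u                     ≡⟨ ℚsolve 2 (λ u v → u :≡ (v :⊕ u) :⊖ v) refl u v ⟩
    (v ℚ.+ u) ℚ.- v       ≡⟨ cong₂ (λ a q → a ℚ.- q ℚ.* g (suc k))
                               (p (suc k)) (/-unique f g h p zero) ⟩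
    h (suc k) ℚ.- (h 0 ℚ.÷ g 0) ℚ.* g (suc k) ∎
    where
    u = (tail f * g) k
    v = f 0 ℚ.* g (suc k)

*-cancelʳ : ∀ f g h .{{_ : ℚ.NonZero (h 0)}} → f * h ≈ g * h → f ≈ g
*-cancelʳ f g h p n = trans (/-unique f h (g * h) p n) (sym (/-unique g h (g * h) (λ _ → refl) n))

-- The Motzkin series

S : PowerSeries
S = √ (C 1 - C 2 * X - C 3 * (X * X))

-- M = (1 - x - S) / (2 x^2), the series of the Motzkin numbers.
M : PowerSeries
M n = ℚ.- (½ ℚ.* S (suc (suc n)))

S≈ : S ≈ C 1 - X - C 2 * (X * (X * M))
S≈ zero       = refl
S≈ (suc zero) = refl
S≈ (suc (suc n)) = sym (begin
  (0ℚ ℚ.+ 0ℚ) ℚ.- (C 2 * (X * (X * M))) (suc (suc n))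
    ≡⟨ cong (λ c → 0ℚ ℚ.- c) (const-* (fromℕ 2) (X * (X * M)) (suc (suc n))) ⟩
  0ℚ ℚ.- fromℕ 2 ℚ.* (X * (X * M)) (suc (suc n))
    ≡⟨ cong (λ c → 0ℚ ℚ.- fromℕ 2 ℚ.* c) (trans (X*-suc (X * M) (suc n)) (X*-suc M n)) ⟩
  0ℚ ℚ.- fromℕ 2 ℚ.* (ℚ.- (½ ℚ.* s))
    ≡⟨ Q.solve 1 (λ s → Q.con 0ℚ Q.:- Q.con (fromℕ 2) Q.:* (Q.:- (Q.con ½ Q.:* s)) Q.:= s) refl s ⟩
  s ∎)
  where
  open ≡-Reasoning
  module Q = ℚ-Solver.+-*-Solver
  s = S (suc (suc n))

module ≈-Reasoning = SetoidReasoning R.setoid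

-- Expanding (1 - x - 2 x^2 M)^2 = 1 - 2x - 3x^2 and dividing by 4 x^2.
M-equation : M ≈ C 1 + X * M + X * X * M * M
M-equation = X*-cancel (X*-cancel (begin
  X * (X * M)
    ≈⟨ solve 2 (λ x m → x :* (x :* m) :=
         x :* (x :* (nat 1 :+ x :* m :+ x :* x :* m :* m))
         :- con ¼ :* (s² x m :* s² x m :- (nat 1 :- nat 2 :* x :- nat 3 :* (x :* x))))
         R.refl X M ⟩
  X * (X * (C 1 + X * M + X * X * M * M)) - const ¼ * (S′ * S′ - D)
    ≈⟨ -‿congˡ (X * (X * (C 1 + X * M + X * X * M * M)))
         (*-congˡ (const ¼) (λ n → cong (ℚ._- D n) (S′² n))) ⟩
  X * (X * (C 1 + X * M + X * X * M * M)) - const ¼ * (D - D)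
    ≈⟨ solve 2 (λ y d → y :- con ¼ :* (d :- d) := y) R.refl
         (X * (X * (C 1 + X * M + X * X * M * M))) D ⟩
  X * (X * (C 1 + X * M + X * X * M * M)) ∎))
  where
  open ≈-Reasoning
  ¼ = ½ ℚ.* ½
  D S′ : PowerSeries
  D = C 1 - C 2 * X - C 3 * (X * X)
  S′ = C 1 - X - C 2 * (X * (X * M))
  s² = λ x m → nat 1 :- x :- nat 2 :* (x :* (x :* m))
  S′² : S′ * S′ ≈ D
  S′² = R.trans (*-cong {S′} {S} {S′} {S} (R.sym S≈) (R.sym S≈)) (√-spec D refl)

-- The generating functions of the completions

denominator : PowerSeries
denominator = C 1 - C 2 * X * M

-- The generating function of the completions with an empty stack: blocks counted
-- by M, separated by letters 1 or 2.
Y : PowerSeries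
Y = M / denominator

Y-equation : Y * denominator ≈ M
Y-equation = /-spec M denominator

-- After multiplication by 1 - 2 x M both sides are polynomials in x and M, and
-- they differ by a multiple of the equation for M.
Y-closed : C 2 * (C 2 - C 7 * X) * (C 1 + X * Y) ≈ C 3 - C 9 * X + S
Y-closed = *-cancelʳ _ _ denominator (begin
  C 2 * (C 2 - C 7 * X) * (C 1 + X * Y) * denominator
    ≈⟨ solve 3 (λ x y d →
         nat 2 :* (nat 2 :- nat 7 :* x) :* (nat 1 :+ x :* y) :* d
         := nat 2 :* (nat 2 :- nat 7 :* x) :* (d :+ x :* (y :* d)))
       R.refl X Y denominator ⟩
  C 2 * (C 2 - C 7 * X) * (denominator + X * (Y * denominator))
    ≈⟨ *-congˡ (C 2 * (C 2 - C 7 * X)) (+-congˡ denominator (*-congˡ X Y-equation)) ⟩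
  C 2 * (C 2 - C 7 * X) * (denominator + X * M)
    ≈⟨ solve 2 (λ x m →
         nat 2 :* (nat 2 :- nat 7 :* x) :* ((nat 1 :- nat 2 :* x :* m) :+ x :* m)
         := (nat 3 :- nat 9 :* x :+ (nat 1 :- x :- nat 2 :* (x :* (x :* m))))
              :* (nat 1 :- nat 2 :* x :* m)
            :+ nat 4 :* x :* (m :- (nat 1 :+ x :* m :+ x :* x :* m :* m)))
       R.refl X M ⟩
  (C 3 - C 9 * X + S′) * denominator + C 4 * X * (M - M′)
    ≈⟨ +-congˡ ((C 3 - C 9 * X + S′) * denominator)
         (*-congˡ (C 4 * X) (-‿congˡ M (R.sym M-equation))) ⟩
  (C 3 - C 9 * X + S′) * denominator + C 4 * X * (M - M)
    ≈⟨ solve 3 (λ x m y → y :+ nat 4 :* x :* (m :- m) := y)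
       R.refl X M ((C 3 - C 9 * X + S′) * denominator) ⟩
  (C 3 - C 9 * X + S′) * denominator
    ≈⟨ *-congʳ denominator (+-congˡ (C 3 - C 9 * X) (R.sym S≈)) ⟩
  (C 3 - C 9 * X + S) * denominator ∎)
  where
  open ≈-Reasoning
  S′ M′ : PowerSeries
  S′ = C 1 - X - C 2 * (X * (X * M))
  M′ = C 1 + X * M + X * X * M * M

-- The generating function of the completions with a stack of height h.
W : ℕ → PowerSeries
W zero    = Y
W (suc h) = (C 1 + X * M) * W h

-- f 0 + ... + f (h - 1)
partialSum : (ℕ → PowerSeries) → ℕ → PowerSeries
partialSum f zero    = const 0ℚ
partialSum f (suc h) = f h + partialSum f h

-- For h = 0 both sides reduce to (1 + 2 x Y) M.  Passing from h to h + 1 adds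
-- x M W_h to the left side and x (1 + x M + x^2 M^2) W_h to the right side.
W-recurrence : ∀ h → W h ≈ C 1 + X * (W (suc h) + (C 2 * W 0 + partialSum W h))
W-recurrence zero = begin
  Y
    ≈⟨ Y≈ ⟩
  M * E
    ≈⟨ *-congʳ E M-equation ⟩
  (C 1 + X * M + X * X * M * M) * E
    ≈⟨ solve 3 (λ x m e → (nat 1 :+ x :* m :+ x :* x :* m :* m) :* e
         := e :+ x :* ((nat 1 :+ x :* m) :* (m :* e))) R.refl X M E ⟩
  E + X * ((C 1 + X * M) * (M * E))
    ≈⟨ +-congˡ E (*-congˡ X (*-congˡ (C 1 + X * M) (R.sym Y≈))) ⟩
  E + X * ((C 1 + X * M) * Y)
    ≈⟨ solve 3 (λ x y w → nat 1 :+ nat 2 :* x :* y :+ x :* w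
         := nat 1 :+ x :* (w :+ (nat 2 :* y :+ con 0ℚ)))
       R.refl X Y ((C 1 + X * M) * Y) ⟩
  C 1 + X * ((C 1 + X * M) * Y + (C 2 * Y + const 0ℚ)) ∎
  where
  open ≈-Reasoning
  E : PowerSeries
  E = C 1 + C 2 * X * Y
  Y≈ : Y ≈ M * E
  Y≈ = begin
    Y
      ≈⟨ solve 3 (λ x y m → y := y :* (nat 1 :- nat 2 :* x :* m)
           :+ m :* (nat 2 :* x :* y)) R.refl X Y M ⟩
    Y * denominator + M * (C 2 * X * Y)
      ≈⟨ (λ n → cong (ℚ._+ (M * (C 2 * X * Y)) n) (Y-equation n)) ⟩
    M + M * (C 2 * X * Y)
      ≈⟨ solve 3 (λ x y m → m :+ m :* (nat 2 :* x :* y)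
           := m :* (nat 1 :+ nat 2 :* x :* y)) R.refl X Y M ⟩
    M * E ∎
W-recurrence (suc h) = begin
  (C 1 + X * M) * W h
    ≈⟨ solve 3 (λ x m w → (nat 1 :+ x :* m) :* w := w :+ x :* w :* m) R.refl X M (W h) ⟩
  W h + X * W h * M
    ≈⟨ +-congˡ (W h) (*-congˡ (X * W h) M-equation) ⟩
  W h + X * W h * (C 1 + X * M + X * X * M * M)
    ≈⟨ (λ n → cong (ℚ._+ (X * W h * (C 1 + X * M + X * X * M * M)) n) (W-recurrence h n)) ⟩
  (C 1 + X * (W (suc h) + (C 2 * Y + partialSum W h))) + X * W h * (C 1 + X * M + X * X * M * M)
    ≈⟨ solve 5 (λ x m y p w →
         (nat 1 :+ x :* ((nat 1 :+ x :* m) :* w :+ (nat 2 :* y :+ p)))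
           :+ x :* w :* (nat 1 :+ x :* m :+ x :* x :* m :* m)
         := nat 1 :+ x :* ((nat 1 :+ x :* m) :* ((nat 1 :+ x :* m) :* w)
              :+ (nat 2 :* y :+ (w :+ p))))
       R.refl X M Y (partialSum W h) (W h) ⟩
  C 1 + X * (W (suc (suc h)) + (C 2 * W 0 + partialSum W (suc h))) ∎
  where open ≈-Reasoning

fromℕ-+ : ∀ a b → fromℕ (a ℕ.+ b) ≡ fromℕ a ℚ.+ fromℕ b
fromℕ-+ a b = ℚ.toℚᵘ-injective (begin
  ℚ.toℚᵘ (fromℕ (a ℕ.+ b))                    ≈⟨ ℚ.toℚᵘ-fromℚᵘ (int (a ℕ.+ b)) ⟩
  int (a ℕ.+ b)                               ≈⟨ ℚᵘ.*≡* (ℤsolve 2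
        (λ a b → (a :⊕ b) :⊗ ℤcon (ℤ.+ 1)
           :≡ (a :⊗ ℤcon (ℤ.+ 1) :⊕ b :⊗ ℤcon (ℤ.+ 1)) :⊗ ℤcon (ℤ.+ 1))
        refl (ℤ.+ a) (ℤ.+ b)) ⟩
  int a ℚᵘ.+ int b
    ≈⟨ ℚᵘ.+-cong (ℚ.toℚᵘ-fromℚᵘ (int a)) (ℚ.toℚᵘ-fromℚᵘ (int b)) ⟨
  ℚ.toℚᵘ (fromℕ a) ℚᵘ.+ ℚ.toℚᵘ (fromℕ b)      ≈⟨ ℚ.toℚᵘ-homo-+ (fromℕ a) (fromℕ b) ⟨
  ℚ.toℚᵘ (fromℕ a ℚ.+ fromℕ b)                ∎)
  where
  open ℤ-Solver.+-*-Solver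
    renaming (solve to ℤsolve; _:=_ to _:≡_; _:+_ to _:⊕_; _:*_ to _:⊗_; con to ℤcon)
  open SetoidReasoning ℚᵘ.≃-setoid
  int : ℕ → ℚᵘ
  int a = mkℚᵘ (ℤ.+ a) 0

-- The recurrence for W h determines the coefficient of x^(n+1) from those of x^n.
completions-series : ∀ n h → fromℕ (completions n h) ≡ W h n
completions-series n h = trans (lemma n h) (sym (W-recurrence h n))
  where
  open ≡-Reasoning
  sum-series : ∀ n h → (∀ j → fromℕ (completions n j) ≡ W j n) →
    fromℕ (sumBelow (completions n) h) ≡ partialSum W h n
  sum-series n zero    p = sym (const-0 n)
  sum-series n (suc h) p = trans (fromℕ-+ (completions n h) _)
    (cong₂ ℚ._+_ (p h) (sum-series n h p))

  fromℕ-double : ∀ a → fromℕ (2 ℕ.* a) ≡ fromℕ 2 ℚ.* fromℕ a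
  fromℕ-double a = trans (cong fromℕ (cong (a ℕ.+_) (ℕ.+-identityʳ a))) (trans (fromℕ-+ a a)
    (Q.solve 1 (λ x → x Q.:+ x Q.:= Q.con (fromℕ 2) Q.:* x) refl (fromℕ a)))
    where
    module Q = ℚ-Solver.+-*-Solver

  lemma : ∀ n h → fromℕ (completions n h) ≡ (C 1 + X * (W (suc h) + (C 2 * W 0 + partialSum W h))) n
  lemma zero    h = cong (1ℚ ℚ.+_) (sym (X*-zero (W (suc h) + (C 2 * W 0 + partialSum W h))))
  lemma (suc n) h = begin
    fromℕ (completions n (suc h) ℕ.+ (2 ℕ.* completions n 0 ℕ.+ sumBelow (completions n) h))
      ≡⟨ trans (fromℕ-+ (completions n (suc h)) _)
           (cong (fromℕ (completions n (suc h)) ℚ.+_) (fromℕ-+ (2 ℕ.* completions n 0) _)) ⟩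
    fromℕ (completions n (suc h)) ℚ.+
      (fromℕ (2 ℕ.* completions n 0) ℚ.+ fromℕ (sumBelow (completions n) h))
      ≡⟨ cong₂ ℚ._+_ (completions-series n (suc h)) (cong₂ ℚ._+_
           (trans (fromℕ-double (completions n 0))
             (trans (cong (fromℕ 2 ℚ.*_) (completions-series n 0))
               (sym (const-* (fromℕ 2) (W 0) n))))
           (sum-series n h (completions-series n))) ⟩
    rest n
      ≡⟨ sym (trans (ℚ.+-identityˡ _) (X*-suc rest n)) ⟩
    (C 1 + X * rest) (suc n) ∎
    where
    rest : PowerSeries
    rest = W (suc h) + (C 2 * W 0 + partialSum W h)

-- The generating function of the words that may follow a block of ones.
A : PowerSeries
A = generatingFunction completionsOfOnes

A-equation : A * (C 1 - X) ≈ C 1 + X * Y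
A-equation = begin
  A * (C 1 - X)
    ≈⟨ solve 2 (λ x a → a :* (nat 1 :- x) := a :- x :* a) R.refl X A ⟩
  A - X * A
    ≈⟨ (λ n → cong (ℚ._- (X * A) n) (recurrence n)) ⟩
  (C 1 + X * (Y + A)) - X * A
    ≈⟨ solve 3 (λ x y a → (nat 1 :+ x :* (y :+ a)) :- x :* a := nat 1 :+ x :* y) R.refl X Y A ⟩
  C 1 + X * Y ∎
  where
  open ≈-Reasoning
  recurrence : A ≈ C 1 + X * (Y + A)
  recurrence zero    = cong (1ℚ ℚ.+_) (sym (X*-zero (Y + A)))
  recurrence (suc n) = trans (fromℕ-+ (completions n 0) (completionsOfOnes n))
    (trans (cong (ℚ._+ A n) (completions-series n 0))
      (sym (trans (ℚ.+-identityˡ _) (X*-suc (Y + A) n))))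

total-series : generatingFunction total
  ≈ C 1 + X * (C 3 - C 9 * X + S) / (C 2 * (C 2 - C 7 * X) * (C 1 - X))
total-series = begin
  generatingFunction total
    ≈⟨ shifted ⟩
  C 1 + X * A
    ≈⟨ +-congˡ (C 1) (/-unique (X * A) _ _ (begin
         X * A * (C 2 * (C 2 - C 7 * X) * (C 1 - X))
           ≈⟨ solve 2 (λ x a → x :* a :* (nat 2 :* (nat 2 :- nat 7 :* x) :* (nat 1 :- x))
                := x :* (nat 2 :* (nat 2 :- nat 7 :* x) :* (a :* (nat 1 :- x)))) R.refl X A ⟩
         X * (C 2 * (C 2 - C 7 * X) * (A * (C 1 - X)))
           ≈⟨ *-congˡ X (*-congˡ (C 2 * (C 2 - C 7 * X)) A-equation) ⟩
         X * (C 2 * (C 2 - C 7 * X) * (C 1 + X * Y))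
           ≈⟨ *-congˡ X Y-closed ⟩
         X * (C 3 - C 9 * X + S) ∎)) ⟩
  C 1 + X * (C 3 - C 9 * X + S) / (C 2 * (C 2 - C 7 * X) * (C 1 - X)) ∎
  where
  open ≈-Reasoning
  shifted : generatingFunction total ≈ C 1 + X * A
  shifted zero    = cong (1ℚ ℚ.+_) (sym (X*-zero A))
  shifted (suc n) = sym (trans (ℚ.+-identityˡ _) (X*-suc A n))

mainTheorem8 : generatingFunction (λ n → ∣𝒫∣ n patterns)
    ≈ C 1 + X * (C 3 - C 9 * X + √ (C 1 - C 2 * X - C 3 * (X * X)))
    / (C 2 * (C 2 - C 7 * X) * (C 1 - X))
mainTheorem8 n = trans (cong fromℕ (∣𝒫∣≡total n)) (total-series n)
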